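{- For all integers $n\ge 2$ and $d$, the $(n-1)\times(n-1)$ matrix $B(n,d)=\bigl(b_{n,d}(i,j)\bigr)_{i,j=1}^{n-1}$ is Toeplitz, i.e. $b_{n,d}(i+1,j+1)=b_{n,d}(i,j)$ for all $i,j\in[n-2]$.
   Context: For a permutation $\pi=\pi_1\cdots\pi_n$ of $[n]$ (one-line notation) or any word of distinct integers, an ascent is a position $t$ with $\pi_t<\pi_{t+1}$ and a descent one with $\pi_t>\pi_{t+1}$; $\operatorname{des}(\pi)$ is the number of descents and the height $h$ of a word is its number of ascents minus its number of descents. $\pi$ is a ballot permutation if every prefix $\pi_1\cdots\pi_t$ ($t\in[n]$) has nonnegative height. $\mathscr{B}_{n,d}$ is the set of ballot permutations of $[n]$ with exactly $d$ descents, and $b_{n,d}(i,j)$ is the number of $\pi\in\mathscr{B}_{n,d}$ that contain $i\,n\,j$ as a factor (consecutive letters $\pi_t=i,\pi_{t+1}=n,\pi_{t+2}=j$ for some $t$). -}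

module Defs where

open import Data.Fin using (Fin; toℕ)
open import Data.Integer using (ℤ; +_; 0ℤ; _⊖_)
import Data.Integer as ℤ
open import Data.List using (List; []; _∷_; applyUpTo; cartesianProductWith; drop; filter; length; take; zip)
open import Data.List.Relation.Binary.Infix.Heterogeneous.Properties using (infix?)
open import Data.List.Relation.Unary.All using (All; all?)
open import Data.List.Relation.Unary.Unique.DecPropositional using (unique?)
open import Data.Nat using (ℕ; zero; suc; _∸_; _<?_; _>?_; _≟_)
open import Data.Product using (_×_; uncurry)
open import Relation.Binary.PropositionalEquality using (_≡_)
open import Relation.Unary using (Decidable)

Word : Set
Word = List ℕ

-- The letters 1, …, n (not 0, …, n − 1).
[_] : ℕ → List ℕ
[ n ] = applyUpTo suc n

words : ℕ → ℕ → List Word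
words n zero    = [] ∷ []
words n (suc k) = cartesianProductWith _∷_ [ n ] (words n k)

-- In one-line notation a permutation of [n] is a word of length n over [n]
-- with no repeated letter; each one is listed exactly once.
permutations : ℕ → List Word
permutations n = filter (unique? _≟_) (words n n)

consecutivePairs : Word → List (ℕ × ℕ)
consecutivePairs w = zip w (drop 1 w)

asc : Word → ℕ
asc w = length (filter (uncurry _<?_) (consecutivePairs w))

des : Word → ℕ
des w = length (filter (uncurry _>?_) (consecutivePairs w))

height : Word → ℤ
height w = asc w ⊖ des w

Ballot : Word → Set
Ballot w = All (λ t → 0ℤ ℤ.≤ height (take t w)) [ length w ]

ballot? : Decidable Ballot
ballot? w = all? (λ t → 0ℤ ℤ.≤? height (take t w)) [ length w ]

-- The number of descents is an arbitrary integer, so the list is empty for d < 0.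
ballotPermutations : ℕ → ℤ → List Word
ballotPermutations n d =
  filter (λ π → + des π ℤ.≟ d) (filter ballot? (permutations n))

b : ℕ → ℤ → ℕ → ℕ → ℕ
b n d i j = length (filter (infix? _≟_ (i ∷ n ∷ j ∷ [])) (ballotPermutations n d))

SquareMatrix : ℕ → Set
SquareMatrix m = Fin m → Fin m → ℕ

-- Indices in Fin m start at 0, so entry (i , j) of B sits at (i − 1 , j − 1).
B : (n : ℕ) → ℤ → SquareMatrix (n ∸ 1)
B n d i j = b n d (suc (toℕ i)) (suc (toℕ j))

Toeplitz : ∀ {m} → SquareMatrix m → Set
Toeplitz {m} M = ∀ (i j i⁺ j⁺ : Fin m) →
  toℕ i⁺ ≡ suc (toℕ i) → toℕ j⁺ ≡ suc (toℕ j) → M i⁺ j⁺ ≡ M i j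

{-# OPTIONS --safe #-}

-- Exchanging the values i and i+1 does not affect the pattern of ascents and
-- descents unless the two letters are adjacent.  Hence b(i,y) and b(i+1,y)
-- differ only by the permutations with factor (i+1) i n y, respectively
-- i (i+1) n y, and likewise b(x,j) and b(x,j+1) by those with factor
-- x n (j+1) j, respectively x n j (j+1).  These corrections cancel: deleting i
-- or i+1 in front of n, renumbering, and inserting j or j+1 behind n slides one
-- step of the height walk past the peak at n, which changes neither the
-- number of descents nor the ballot condition.  So b(i,j) and b(i+1,j+1) can be
-- compared through b(i,j+1) if i < j, and through b(i+1,j) if j < i.
module Submission where

open import Data.Fin using (Fin; zero; suc; toℕ)
open import Data.Fin.Properties using (injective⇒≤; toℕ<n)
open import Data.Integer using (ℤ; 0ℤ; _⊖_)
import Data.Integer as ℤ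
import Data.Integer.Properties as ℤ
open import Data.List using (List; []; _∷_; _++_; _∷ʳ_; length; map; filter; lookup; take)
open import Data.List.Membership.Propositional using (_∈_)
open import Data.List.Membership.Propositional.Properties
  using (∈-filter⁺; ∈-filter⁻; ∈-applyUpTo⁺; ∈-applyUpTo⁻; ∈-cartesianProductWith⁺; ∈-cartesianProductWith⁻; ∈-insert; ∈-lookup)
open import Data.List.Properties
  using (filter-accept; filter-reject; map-++; length-map; map-cong; map-id; map-∘; map-id-local; ++-assoc; ++-cancelˡ;
         ∷-injective; ∷-injectiveˡ; ∷-injectiveʳ; ∷ʳ-injectiveʳ; ∷ʳ-++)
open import Data.List.Relation.Binary.Infix.Heterogeneous using (Infix; MkView; toView; fromView)
open import Data.List.Relation.Binary.Infix.Heterogeneous.Properties using (infix?)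
open import Data.List.Relation.Binary.Permutation.Propositional using (_↭_; ↭-sym; ↭-trans; ↭⇒↭ₛ)
import Data.List.Relation.Binary.Permutation.Propositional as ↭
open import Data.List.Relation.Binary.Permutation.Propositional.Properties using (↭-length; All-resp-↭; ++⁺ˡ; shift)
import Data.List.Relation.Binary.Permutation.Setoid.Properties as ↭ₛ
open import Data.List.Relation.Binary.Pointwise using (Pointwise-≡⇒≡; ≡⇒Pointwise-≡)
open import Data.List.Relation.Unary.All as All using (All; []; _∷_)
import Data.List.Relation.Unary.All.Properties as All
open import Data.List.Relation.Unary.AllPairs using ([]; _∷_)
open import Data.List.Relation.Unary.Any using (here; index)
open import Data.List.Relation.Unary.Any.Properties using (lookup-index)
open import Data.List.Relation.Unary.Unique.DecPropositional using (unique?)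
open import Data.List.Relation.Unary.Unique.Propositional using (Unique)
import Data.List.Relation.Unary.Unique.Propositional.Properties as Unique
open import Data.Maybe as Maybe using (Maybe; just; nothing)
open import Data.Maybe.Properties using (just-injective)
open import Data.Nat using (ℕ; zero; suc; pred; _+_; _≤_; _<_; _≥_; _>_; _<?_; _>?_; _≟_; z≤n; s≤s; s≤s⁻¹)
open import Data.Nat.Properties
  using (≤-refl; ≤-antisym; <⇒≤; <⇒≢; >⇒≢; <-trans; <-cmp; m<n⇒m<1+n; suc-injective; +-suc; +-comm; +-assoc; +-cancelʳ-≡)
open import Data.Product using (∃; ∃₂; _×_; _,_; proj₁; proj₂; uncurry) renaming (swap to ×-swap)
open import Function using (_∘_; case_of_)
open import Level using (0ℓ)
open import Relation.Binary.Definitions using (tri<; tri≈; tri>)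
open import Relation.Binary.PropositionalEquality hiding ([_])
open import Relation.Nullary using (¬_; yes; no; contradiction)
open import Relation.Nullary.Decidable using (¬?)
open import Relation.Unary using (Pred; Decidable)
open import Defs

private variable
  A : Set
  a c k n x x′ y y′ : ℕ
  d : ℤ
  p q u v w : Word

-- Counting by injections

lookup-injective : {xs : List A} → Unique xs → ∀ i j → lookup xs i ≡ lookup xs j → i ≡ j
lookup-injective {xs = _ ∷ _} _          zero    zero    _  = refl
lookup-injective {xs = _ ∷ _} (x∉xs ∷ _) zero    (suc j) eq = contradiction eq (All.lookup x∉xs (∈-lookup j))
lookup-injective {xs = _ ∷ _} (x∉xs ∷ _) (suc i) zero    eq = contradiction (sym eq) (All.lookup x∉xs (∈-lookup i))
lookup-injective {xs = _ ∷ _} (_ ∷ u)    (suc i) (suc j) eq = cong suc (lookup-injective u i j eq)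

-- Sending each position of `xs` to the position of its image in `ys` is an injection of `Fin`
-- types. A relation replaces a function because later images are built from a decomposition of the
-- word at a factor, not from the word alone.
length-≤ : {xs ys : List A} (R : A → A → Set) → Unique xs →
           (∀ {x} → x ∈ xs → ∃ λ y → y ∈ ys × R x y) →
           (∀ {x x′ y} → y ∈ ys → R x y → R x′ y → x ≡ x′) →
           length xs ≤ length ys
length-≤ {xs = xs} {ys} R unique image injective = injective⇒≤ {f = λ i → index (y∈ys i)} λ {i} {j} eq →
  lookup-injective unique i j (injective (y∈ys j) (subst (R _) (same eq) (related i)) (related j))
  where
  y∈ys : ∀ i → proj₁ (image (∈-lookup {xs = xs} i)) ∈ ys
  y∈ys i = proj₁ (proj₂ (image (∈-lookup i)))

  related : ∀ i → R (lookup xs i) (proj₁ (image (∈-lookup {xs = xs} i)))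
  related i = proj₂ (proj₂ (image (∈-lookup i)))

  same : ∀ {i j} → index (y∈ys i) ≡ index (y∈ys j) → proj₁ (image (∈-lookup i)) ≡ proj₁ (image (∈-lookup j))
  same {i} {j} eq = trans (lookup-index (y∈ys i)) (trans (cong (lookup ys) eq) (sym (lookup-index (y∈ys j))))

length-filter-split : {P Q : Pred A 0ℓ} (P? : Decidable P) (Q? : Decidable Q) →
                      (∀ {x} → Q x → P x) → ∀ xs →
                      length (filter P? xs) ≡
                      length (filter Q? xs) + length (filter (¬? ∘ Q?) (filter P? xs))
length-filter-split P? Q? Q⇒P []       = refl
length-filter-split P? Q? Q⇒P (x ∷ xs) with P? x | Q? x
... | yes p | yes q = cong suc (trans (length-filter-split P? Q? Q⇒P xs)
        (cong (λ ys → length (filter Q? xs) + length ys) (sym (filter-reject (¬? ∘ Q?) (λ ¬q → ¬q q)))))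
... | yes p | no ¬q = trans (cong suc (length-filter-split P? Q? Q⇒P xs))
        (trans (sym (+-suc _ _))
               (cong (λ ys → length (filter Q? xs) + length ys) (sym (filter-accept (¬? ∘ Q?) ¬q))))
... | no ¬p | yes q = contradiction (Q⇒P q) ¬p
... | no ¬p | no ¬q = length-filter-split P? Q? Q⇒P xs

-- Ballot words as nonnegative walks

-- `flat` makes `step` total. It never occurs between distinct letters, but having it lets the walk
-- lemmas hold for arbitrary words.
data Step : Set where
  up flat down : Step

step : ℕ → ℕ → Step
step zero    zero    = flat
step zero    (suc y) = up
step (suc x) zero    = down
step (suc x) (suc y) = step x y

step-< : x < y → step x y ≡ up
step-< {zero}  (s≤s _)   = refl
step-< {suc x} (s≤s x<y) = step-< x<y

step-> : x > y → step x y ≡ down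
step-> {y = zero}  (s≤s _)   = refl
step-> {y = suc y} (s≤s x>y) = step-> x>y

step-refl : ∀ x → step x x ≡ flat
step-refl zero    = refl
step-refl (suc x) = step-refl x

step-preserved : (f : ℕ → ℕ) → (x < y → f x < f y) → (y < x → f y < f x) → step (f x) (f y) ≡ step x y
step-preserved {x} {y} f mono antimono with <-cmp x y
... | tri< x<y _ _  = trans (step-< (mono x<y)) (sym (step-< x<y))
... | tri≈ _ refl _ = trans (step-refl (f x)) (sym (step-refl x))
... | tri> _ _ x>y  = trans (step-> (antimono x>y)) (sym (step-> x>y))

steps : Word → List Step
steps (x ∷ y ∷ w) = step x y ∷ steps (y ∷ w)
steps _           = []

-- The letter at the cut belongs to both halves, since otherwise the step across the cut would be
-- lost.
steps-++ : ∀ u {x v} → steps (u ++ x ∷ v) ≡ steps (u ++ x ∷ []) ++ steps (x ∷ v)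
steps-++ []          = refl
steps-++ (y ∷ [])    = refl
steps-++ (y ∷ z ∷ u) = cong (step y z ∷_) (steps-++ (z ∷ u))

-- The condition concerns only pairs that are adjacent in `w`, so that it also covers maps that are
-- not monotone, such as `swap k`.
steps-map : (f : ℕ → ℕ) → ∀ w →
            (∀ {x y} u {v} → w ≡ u ++ x ∷ y ∷ v → step (f x) (f y) ≡ step x y) →
            steps (map f w) ≡ steps w
steps-map f []          preserved = refl
steps-map f (x ∷ [])    preserved = refl
steps-map f (x ∷ y ∷ w) preserved =
  cong₂ _∷_ (preserved [] refl) (steps-map f (y ∷ w) λ u eq → preserved (x ∷ u) (cong (x ∷_) eq))

-- The number of down steps, provided that the walk started at height h never
-- goes below 0.
run : ℕ → List Step → Maybe ℕ
run h       []          = just 0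
run h       (up   ∷ ss) = run (suc h) ss
run h       (flat ∷ ss) = run h ss
run zero    (down ∷ ss) = nothing
run (suc h) (down ∷ ss) = Maybe.map suc (run h ss)

run-++ : ∀ ss {ts ts′} → (∀ h → run h ts ≡ run h ts′) → ∀ h → run h (ss ++ ts) ≡ run h (ss ++ ts′)
run-++ []          eq h       = eq h
run-++ (up   ∷ ss) eq h       = run-++ ss eq (suc h)
run-++ (flat ∷ ss) eq h       = run-++ ss eq h
run-++ (down ∷ ss) eq zero    = refl
run-++ (down ∷ ss) eq (suc h) = cong (Maybe.map suc) (run-++ ss eq h)

-- An up step followed by a down step returns to its starting height without going below it, so `s`
-- is taken from height `h` in both orders. In particular a down step from height 0 fails on both
-- sides.
run-slide : ∀ s {ss} h → run h (s ∷ up ∷ down ∷ ss) ≡ run h (up ∷ down ∷ s ∷ ss)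
run-slide up   h       = refl
run-slide flat h       = refl
run-slide down zero    = refl
run-slide down (suc h) = refl

asc-< : x < y → asc (x ∷ y ∷ w) ≡ suc (asc (y ∷ w))
asc-< x<y = cong length (filter-accept (uncurry _<?_) x<y)

asc-≮ : ¬ x < y → asc (x ∷ y ∷ w) ≡ asc (y ∷ w)
asc-≮ x≮y = cong length (filter-reject (uncurry _<?_) x≮y)

des-> : x > y → des (x ∷ y ∷ w) ≡ suc (des (y ∷ w))
des-> x>y = cong length (filter-accept (uncurry _>?_) x>y)

des-≯ : ¬ x > y → des (x ∷ y ∷ w) ≡ des (y ∷ w)
des-≯ x≯y = cong length (filter-reject (uncurry _>?_) x≯y)

-- The ballot condition for a walk that starts at height `h`, as needed for induction along the
-- word. The first letter is split off so that every prefix considered is nonempty.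
BallotFrom : ℕ → ℕ → Word → Set
BallotFrom h x w = ∀ {t} → t ≤ length w → des (x ∷ take t w) ≤ h + asc (x ∷ take t w)

ballot⇒run : ∀ h x w → BallotFrom h x w → run h (steps (x ∷ w)) ≡ just (des (x ∷ w))
ballot⇒run h x []      ballot = refl
ballot⇒run h x (y ∷ w) ballot with <-cmp x y
... | tri< x<y _ x≯y rewrite step-< x<y | des-≯ {w = w} x≯y = ballot⇒run (suc h) y w λ {t} t≤ →
  subst₂ _≤_ (des-≯ {w = take t w} x≯y)
    (trans (cong (h +_) (asc-< {w = take t w} x<y)) (+-suc h _)) (ballot (s≤s t≤))
... | tri≈ x≮y refl x≯y rewrite step-refl x | des-≯ {w = w} x≯y = ballot⇒run h y w λ {t} t≤ →
  subst₂ _≤_ (des-≯ {w = take t w} x≯y) (cong (h +_) (asc-≮ {w = take t w} x≮y)) (ballot (s≤s t≤))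
... | tri> x≮y _ x>y rewrite step-> x>y | des-> {w = w} x>y = descend h λ {t} t≤ →
  subst₂ _≤_ (des-> {w = take t w} x>y) (cong (h +_) (asc-≮ {w = take t w} x≮y)) (ballot (s≤s t≤))
  where
  descend : ∀ h → (∀ {t} → t ≤ length w → suc (des (y ∷ take t w)) ≤ h + asc (y ∷ take t w)) →
            run h (down ∷ steps (y ∷ w)) ≡ just (suc (des (y ∷ w)))
  -- The prefix `x ∷ y ∷ []` has one descent and no ascent, so it cannot start at height 0.
  descend zero    below = contradiction (below z≤n) λ ()
  descend (suc h) below = cong (Maybe.map suc) (ballot⇒run h y w λ t≤ → s≤s⁻¹ (below t≤))

run⇒ballot : ∀ h x w → run h (steps (x ∷ w)) ≡ just k → BallotFrom h x w
run⇒ballot h x w       eq {zero}  _ = z≤n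
run⇒ballot h x []      eq {suc t} _ = z≤n
run⇒ballot h x (y ∷ w) eq {suc t} (s≤s t≤) with <-cmp x y
... | tri< x<y _ x≯y rewrite step-< x<y | des-≯ {w = take t w} x≯y | asc-< {w = take t w} x<y | +-suc h (asc (y ∷ take t w)) =
  run⇒ballot (suc h) y w eq t≤
... | tri≈ x≮y refl x≯y rewrite step-refl x | des-≯ {w = take t w} x≯y | asc-≮ {w = take t w} x≮y =
  run⇒ballot h y w eq t≤
run⇒ballot (suc h) x (y ∷ w) eq {suc t} (s≤s t≤) | tri> x≮y _ x>y
  rewrite step-> x>y | des-> {w = take t w} x>y | asc-≮ {w = take t w} x≮y
  -- `Maybe.map suc` yields a `just` only if the remaining run succeeds; the value itself is
  -- irrelevant.
  with just _ ← run h (steps (y ∷ w)) in eq′ = s≤s (run⇒ballot h y w eq′ t≤)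
run⇒ballot zero x (y ∷ w) eq {suc t} (s≤s t≤) | tri> x≮y _ x>y
  rewrite step-> x>y with () ← eq

-- This is `just` the number of descents for a ballot word and `nothing` for any other, so one
-- equation transports both properties.
profile : Word → Maybe ℕ
profile w = run 0 (steps w)

0≤⊖⇒≥ : ∀ m n → 0ℤ ℤ.≤ m ⊖ n → n ≤ m
0≤⊖⇒≥ m n 0≤ = ℤ.drop‿+≤+ (ℤ.0≤i-j⇒j≤i (subst (0ℤ ℤ.≤_) (sym (ℤ.m-n≡m⊖n m n)) 0≤))

≥⇒0≤⊖ : ∀ m n → n ≤ m → 0ℤ ℤ.≤ m ⊖ n
≥⇒0≤⊖ m n n≤m = subst (0ℤ ℤ.≤_) (ℤ.m-n≡m⊖n m n) (ℤ.i≤j⇒0≤j-i (ℤ.+≤+ n≤m))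

Ballot⇒profile : ∀ w → Ballot w → profile w ≡ just (des w)
Ballot⇒profile []      _      = refl
Ballot⇒profile (x ∷ w) ballot = ballot⇒run 0 x w λ {t} t≤ →
  -- Index `t` of `applyUpTo suc` stands for the prefix of length `suc t`, which is `x ∷ take t w`.
  0≤⊖⇒≥ (asc (x ∷ take t w)) _ (All.applyUpTo⁻ suc _ ballot (s≤s t≤))

profile⇒Ballot : ∀ w → profile w ≡ just k → Ballot w
profile⇒Ballot []      _  = []
profile⇒Ballot (x ∷ w) eq = All.applyUpTo⁺₁ suc _ λ {t} t< →
  ≥⇒0≤⊖ (asc (x ∷ take t w)) _ (run⇒ballot 0 x w eq (s≤s⁻¹ t<))

profile-preserves-Ballot : profile v ≡ profile w → Ballot v → Ballot w
profile-preserves-Ballot {v} {w} eq ballot = profile⇒Ballot w (trans (sym eq) (Ballot⇒profile v ballot))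

profile-preserves-des : profile v ≡ profile w → Ballot v → des v ≡ des w
profile-preserves-des {v} {w} eq ballot = just-injective
  (trans (sym (Ballot⇒profile v ballot)) (trans eq (Ballot⇒profile w (profile-preserves-Ballot {v} {w} eq ballot))))

-- Relabelling letters

punchIn : ℕ → ℕ → ℕ
punchIn zero    x       = suc x
punchIn (suc a) zero    = zero
punchIn (suc a) (suc x) = suc (punchIn a x)

-- The value at `a` itself is a default; order and distinctness are preserved only away from `a`.
punchOut : ℕ → ℕ → ℕ
punchOut zero    x       = pred x
punchOut (suc a) zero    = zero
punchOut (suc a) (suc x) = suc (punchOut a x)

punchIn-< : x < a → punchIn a x ≡ x
punchIn-< {zero}  (s≤s _)   = refl
punchIn-< {suc x} (s≤s x<a) = cong suc (punchIn-< x<a)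

punchIn-≥ : a ≤ x → punchIn a x ≡ suc x
punchIn-≥ z≤n       = refl
punchIn-≥ (s≤s a≤x) = cong suc (punchIn-≥ a≤x)

punchOut-< : x < a → punchOut a x ≡ x
punchOut-< {zero}  (s≤s _)   = refl
punchOut-< {suc x} (s≤s x<a) = cong suc (punchOut-< x<a)

punchOut-≥ : a ≤ x → punchOut a (suc x) ≡ x
punchOut-≥ z≤n       = refl
punchOut-≥ (s≤s a≤x) = cong suc (punchOut-≥ a≤x)

punchIn-mono-< : ∀ a → x < y → punchIn a x < punchIn a y
punchIn-mono-< zero    x<y = s≤s x<y
punchIn-mono-< {zero} (suc a) (s≤s _) = s≤s z≤n
punchIn-mono-< {suc x} (suc a) (s≤s x<y) = s≤s (punchIn-mono-< a x<y)

punchInᵢ≢i : ∀ a x → punchIn a x ≢ a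
punchInᵢ≢i (suc a) (suc x) eq = punchInᵢ≢i a x (suc-injective eq)

punchOut-punchIn : ∀ a x → punchOut a (punchIn a x) ≡ x
punchOut-punchIn zero    x       = refl
punchOut-punchIn (suc a) zero    = refl
punchOut-punchIn (suc a) (suc x) = cong suc (punchOut-punchIn a x)

punchIn-punchOut : ∀ a x → x ≢ a → punchIn a (punchOut a x) ≡ x
punchIn-punchOut zero    zero    x≢a = contradiction refl x≢a
punchIn-punchOut zero    (suc x) x≢a = refl
punchIn-punchOut (suc a) zero    x≢a = refl
punchIn-punchOut (suc a) (suc x) x≢a = cong suc (punchIn-punchOut a x (x≢a ∘ cong suc))

punchOut-mono-< : ∀ a → x ≢ a → y ≢ a → x < y → punchOut a x < punchOut a y
punchOut-mono-< {zero} zero x≢a y≢a x<y = contradiction refl x≢a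
punchOut-mono-< {suc x} zero x≢a y≢a (s≤s x<y) = x<y
punchOut-mono-< {zero}  {suc y} (suc a) x≢a y≢a x<y = s≤s z≤n
punchOut-mono-< {suc x} {suc y} (suc a) x≢a y≢a (s≤s x<y) =
  s≤s (punchOut-mono-< a (x≢a ∘ cong suc) (y≢a ∘ cong suc) x<y)

-- The order isomorphism from ℕ ∖ {a} to ℕ ∖ {c}.
relabel : ℕ → ℕ → ℕ → ℕ
relabel a c x = punchIn c (punchOut a x)

relabel-≢ : ∀ a c x → relabel a c x ≢ c
relabel-≢ a c x = punchInᵢ≢i c _

relabel-inverse : ∀ a c → x ≢ a → relabel c a (relabel a c x) ≡ x
relabel-inverse a c x≢a = trans (cong (punchIn a) (punchOut-punchIn c _)) (punchIn-punchOut a _ x≢a)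

relabel-mono-< : ∀ a c → x ≢ a → y ≢ a → x < y → relabel a c x < relabel a c y
relabel-mono-< a c x≢a y≢a = punchIn-mono-< c ∘ punchOut-mono-< a x≢a y≢a

InRange : ℕ → ℕ → Set
InRange n x = 1 ≤ x × x ≤ n

-- Closing the gap at `a` frees one place below the upper bound, and opening a gap at `c` uses it
-- up.
relabel-InRange : InRange n a → 1 ≤ c → x ≢ a → InRange n x → InRange n (relabel a c x)
relabel-InRange {n} {suc a} {suc c} {suc x} (_ , s≤s a≤n) _ x≢a (_ , s≤s x≤n) =
  s≤s z≤n , s≤s (punchIn-≤ c (punchOut-≤ a≤n x≤n (x≢a ∘ cong suc)))
  where
  punchIn-≤ : ∀ c {y m} → y < m → punchIn c y ≤ m
  punchIn-≤ zero    y<m                   = y<m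
  punchIn-≤ (suc c) {zero}  y<m       = z≤n
  punchIn-≤ (suc c) {suc y} (s≤s y<m) = s≤s (punchIn-≤ c y<m)

  punchOut-≤ : ∀ {a x m} → a ≤ m → x ≤ m → x ≢ a → punchOut a x < m
  punchOut-≤ {zero}  {zero}  a≤m       x≤m       x≢a = contradiction refl x≢a
  punchOut-≤ {zero}  {suc x} a≤m       x≤m       x≢a = x≤m
  punchOut-≤ {suc a} {zero}  (s≤s a≤m) x≤m       x≢a = s≤s z≤n
  punchOut-≤ {suc a} {suc x} (s≤s a≤m) (s≤s x≤m) x≢a = s≤s (punchOut-≤ a≤m x≤m (x≢a ∘ cong suc))

-- Applied to the maximum `n`, this keeps the peak in place under relabelling.
relabel-> : a < x → c < x → relabel a c x ≡ x
relabel-> {a} {suc x} {c} (s≤s a≤x) (s≤s c≤x) = trans (cong (punchIn c) (punchOut-≥ a≤x)) (punchIn-≥ c≤x)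

relabel-< : x < a → x < c → relabel a c x ≡ x
relabel-< {c = c} x<a x<c = trans (cong (punchIn c) (punchOut-< x<a)) (punchIn-< x<c)

relabel-down : a ≤ x → x < c → relabel a c (suc x) ≡ x
relabel-down {c = c} a≤x x<c = trans (cong (punchIn c) (punchOut-≥ a≤x)) (punchIn-< x<c)

relabel-up : c ≤ x → x < a → relabel a c x ≡ suc x
relabel-up {c} c≤x x<a = trans (cong (punchIn c) (punchOut-< x<a)) (punchIn-≥ c≤x)

swap : ℕ → ℕ → ℕ
swap zero    zero          = 1
swap zero    (suc zero)    = 0
swap zero    (suc (suc x)) = suc (suc x)
swap (suc k) zero          = zero
swap (suc k) (suc x)       = suc (swap k x)

swap-k : ∀ k → swap k k ≡ suc k
swap-k zero    = refl
swap-k (suc k) = cong suc (swap-k k)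

swap-1+k : ∀ k → swap k (suc k) ≡ k
swap-1+k zero    = refl
swap-1+k (suc k) = cong suc (swap-1+k k)

swap-fixed : ∀ k x → x ≢ k → x ≢ suc k → swap k x ≡ x
swap-fixed zero    zero          ≢k ≢1+k = contradiction refl ≢k
swap-fixed zero    (suc zero)    ≢k ≢1+k = contradiction refl ≢1+k
swap-fixed zero    (suc (suc x)) ≢k ≢1+k = refl
swap-fixed (suc k) zero          ≢k ≢1+k = refl
swap-fixed (suc k) (suc x)       ≢k ≢1+k = cong suc (swap-fixed k x (≢k ∘ cong suc) (≢1+k ∘ cong suc))

swap-involutive : ∀ k x → swap k (swap k x) ≡ x
swap-involutive zero    zero          = refl
swap-involutive zero    (suc zero)    = refl
swap-involutive zero    (suc (suc x)) = refl
swap-involutive (suc k) zero          = refl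
swap-involutive (suc k) (suc x)       = cong suc (swap-involutive k x)

swap-injective : ∀ k → swap k x ≡ swap k y → x ≡ y
swap-injective k eq = trans (sym (swap-involutive k _)) (trans (cong (swap k) eq) (swap-involutive k _))

-- No letter lies strictly between `k` and `suc k`, so each of them compares in the same way with
-- any third letter.
swap-mono-< : ∀ k → ¬ (x ≡ k × y ≡ suc k) → x < y → swap k x < swap k y
swap-mono-< {zero}        {suc zero} zero ¬adj x<y       = contradiction (refl , refl) ¬adj
swap-mono-< {zero}        {suc (suc y)} zero ¬adj x<y       = s≤s (s≤s z≤n)
swap-mono-< {suc zero}    {suc (suc y)} zero ¬adj x<y       = s≤s z≤n
swap-mono-< {suc (suc x)} {suc (suc y)} zero ¬adj x<y       = x<y
swap-mono-< {suc x}       {suc zero} zero ¬adj (s≤s ())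
swap-mono-< {zero}        {suc y} (suc k) ¬adj x<y       = s≤s z≤n
swap-mono-< {suc x}       {suc y} (suc k) ¬adj (s≤s x<y) =
  s≤s (swap-mono-< k (λ { (refl , refl) → ¬adj (refl , refl) }) x<y)

swap-InRange : ∀ k → 1 ≤ k → suc k ≤ n → InRange n x → InRange n (swap k x)
swap-InRange {suc n} {suc x} (suc k) _ (s≤s k<n) (_ , s≤s x≤n) = s≤s z≤n , s≤s (bound k x k<n x≤n)
  where
  bound : ∀ {n} k x → k < n → x ≤ n → swap k x ≤ n
  bound zero    zero          k<n       x≤n       = k<n
  bound zero    (suc zero)    k<n       x≤n       = z≤n
  bound zero    (suc (suc x)) k<n       x≤n       = x≤n
  bound (suc k) zero          (s≤s k<n) x≤n       = z≤n
  bound (suc k) (suc x)       (s≤s k<n) (s≤s x≤n) = s≤s (bound k x k<n x≤n)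

-- Factors of ballot permutations

Permutation : ℕ → Word → Set
Permutation n w = length w ≡ n × All (InRange n) w × Unique w

BallotPermutation : ℕ → ℤ → Word → Set
BallotPermutation n d w = Permutation n w × Ballot w × ℤ.+ des w ≡ d

∈-[]⁺ : InRange n x → x ∈ [ n ]
∈-[]⁺ {x = suc x} (_ , x<n) = ∈-applyUpTo⁺ suc x<n

∈-[]⁻ : x ∈ [ n ] → InRange n x
∈-[]⁻ x∈ with _ , i<n , refl ← ∈-applyUpTo⁻ suc x∈ = s≤s z≤n , i<n

∈-words⁺ : ∀ w → All (InRange n) w → w ∈ words n (length w)
∈-words⁺ []      []        = here refl
∈-words⁺ (x ∷ w) (px ∷ pw) = ∈-cartesianProductWith⁺ _∷_ (∈-[]⁺ px) (∈-words⁺ w pw)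

∈-words⁻ : ∀ k → w ∈ words n k → length w ≡ k × All (InRange n) w
∈-words⁻         zero    (here refl) = refl , []
∈-words⁻ {n = n} (suc k) w∈ with _ , _ , x∈ , w∈′ , refl ← ∈-cartesianProductWith⁻ _∷_ [ n ] (words n k) w∈ =
  let length≡ , inRange = ∈-words⁻ k w∈′ in cong suc length≡ , ∈-[]⁻ x∈ ∷ inRange

words-unique : ∀ n k → Unique (words n k)
words-unique n zero    = [] ∷ []
words-unique n (suc k) = Unique.cartesianProductWith⁺ _∷_ ∷-injective
  (Unique.applyUpTo⁺₁ suc n (λ i<j _ → <⇒≢ i<j ∘ suc-injective)) (words-unique n k)

∈-ballotPermutations⁺ : BallotPermutation n d w → w ∈ ballotPermutations n d
∈-ballotPermutations⁺ {w = w} ((refl , inRange , unique) , ballot , des≡) =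
  ∈-filter⁺ (λ π → ℤ.+ des π ℤ.≟ _)
    (∈-filter⁺ ballot? (∈-filter⁺ (unique? _≟_) (∈-words⁺ w inRange) unique) ballot) des≡

∈-ballotPermutations⁻ : ∀ n d → w ∈ ballotPermutations n d → BallotPermutation n d w
∈-ballotPermutations⁻ n d w∈ =
  let w∈₁ , des≡    = ∈-filter⁻ (λ π → ℤ.+ des π ℤ.≟ d) w∈
      w∈₂ , ballot  = ∈-filter⁻ ballot? w∈₁
      w∈₃ , unique  = ∈-filter⁻ (unique? _≟_) {xs = words n n} w∈₂
      len , inRange = ∈-words⁻ n w∈₃
  in (len , inRange , unique) , ballot , des≡

ballotPermutations-unique : ∀ n d → Unique (ballotPermutations n d)
ballotPermutations-unique n d = Unique.filter⁺ (λ π → ℤ.+ des π ℤ.≟ d)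
  (Unique.filter⁺ ballot? (Unique.filter⁺ (unique? _≟_) (words-unique n n)))

profile-preserves : profile v ≡ profile w → Permutation n w → BallotPermutation n d v → BallotPermutation n d w
profile-preserves {v} {w} eq perm (_ , ballot , des≡) =
  perm , profile-preserves-Ballot {v} {w} eq ballot ,
  trans (cong ℤ.+_ (sym (profile-preserves-des {v} {w} eq ballot))) des≡

Factor : Word → Word → Set
Factor = Infix _≡_

split : Factor p w → ∃₂ λ u v → w ≡ u ++ p ++ v
split p⊑w with MkView u p≡ v ← toView p⊑w with refl ← Pointwise-≡⇒≡ p≡ = u , v , refl

unsplit : ∀ u {v} → w ≡ u ++ p ++ v → Factor p w
unsplit u refl = fromView (MkView u (≡⇒Pointwise-≡ refl) _)

-- If the two cuts differed, `x` would occur twice. Hence any one letter of a factor fixes the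
-- position of the factor.
split-unique : ∀ u {u′ v v′} → Unique (u ++ x ∷ v) → u ++ x ∷ v ≡ u′ ++ x ∷ v′ → u ≡ u′ × v ≡ v′
split-unique []      {[]}     _        eq   = refl , ∷-injectiveʳ eq
split-unique []      {_ ∷ u′} (x∉ ∷ _) refl = contradiction refl (All.lookup x∉ (∈-insert u′))
split-unique (_ ∷ u) {[]}     (x∉ ∷ _) refl = contradiction refl (All.lookup x∉ (∈-insert u))
split-unique (_ ∷ u) {_ ∷ u′} (_ ∷ un) eq with refl , eq′ ← ∷-injective eq
  with refl , refl ← split-unique u un eq′ = refl , refl

containing : ℕ → ℤ → Word → List Word
containing n d p = filter (infix? _≟_ p) (ballotPermutations n d)

count : ℕ → ℤ → Word → ℕ
count n d p = length (containing n d p)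

∈-containing⁺ : Factor p w → BallotPermutation n d w → w ∈ containing n d p
∈-containing⁺ p⊑w good = ∈-filter⁺ (infix? _≟_ _) (∈-ballotPermutations⁺ good) p⊑w

∈-containing⁻ : ∀ n d → w ∈ containing n d p → BallotPermutation n d w × Factor p w
∈-containing⁻ n d w∈ =
  let w∈′ , p⊑w = ∈-filter⁻ (infix? _≟_ _) {xs = ballotPermutations n d} w∈
  in ∈-ballotPermutations⁻ n d w∈′ , p⊑w

BallotPermutation⇒Unique : BallotPermutation n d w → Unique w
BallotPermutation⇒Unique ((_ , _ , unique) , _) = unique

-- Exchanging two consecutive values

NonAdjacent : ℕ → Word → Set
NonAdjacent k w = ¬ Factor (k ∷ suc k ∷ []) w × ¬ Factor (suc k ∷ k ∷ []) w

map-swap-involutive : ∀ k w → map (swap k) (map (swap k) w) ≡ w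
map-swap-involutive k w = trans (sym (map-∘ w)) (trans (map-cong (swap-involutive k) w) (map-id w))

Factor-map : (f : ℕ → ℕ) → Factor p w → Factor (map f p) (map f w)
Factor-map {p} f p⊑w with u , v , refl ← split p⊑w =
  unsplit (map f u) (trans (map-++ f u (p ++ v)) (cong (map f u ++_) (map-++ f p v)))

steps-swap : ∀ k w → NonAdjacent k w → steps (map (swap k) w) ≡ steps w
steps-swap k w (¬adj , ¬adj′) = steps-map (swap k) w λ u eq → step-preserved (swap k)
  (swap-mono-< k λ { (refl , refl) → ¬adj  (unsplit u eq) })
  (swap-mono-< k λ { (refl , refl) → ¬adj′ (unsplit u eq) })

swap-BallotPermutation : 1 ≤ k → suc k ≤ n → NonAdjacent k w →
                         BallotPermutation n d w → BallotPermutation n d (map (swap k) w)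
swap-BallotPermutation {k} {w = w} 1≤k k<n ¬adj good@((len , inRange , unique) , _) =
  profile-preserves {w} {map (swap k) w} (cong (run 0) (sym (steps-swap k w ¬adj)))
    ( trans (length-map (swap k) w) len
    , All.map⁺ (All.map (swap-InRange k 1≤k k<n) inRange)
    , Unique.map⁺ (swap-injective k) unique )
    good

avoiding : ℕ → ℤ → Word → Word → List Word
avoiding n d p q = filter (¬? ∘ infix? _≟_ q) (containing n d p)

-- In the applications `q` extends `p` by one letter, putting `k` and `suc k` side by side, and this
-- is the only way in which they can be adjacent in a word with factor `p`.
Separates : ℕ → Word → Word → Set
Separates k p q = ∀ {w} → Unique w → Factor p w → ¬ Factor q w → NonAdjacent k w

-- Being an involution, `swap k` acts injectively on words. The equation for `q′` points towards `q`
-- because a factor `q′` of the image is pulled back to a factor `q` of the original.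
swap-≤ : ∀ {k n d} p q {p′ q′} → 1 ≤ k → suc k ≤ n → Separates k p q →
         map (swap k) p ≡ p′ → map (swap k) q′ ≡ q →
         length (avoiding n d p q) ≤ length (avoiding n d p′ q′)
swap-≤ {k} {n} {d} p q 1≤k k<n separates refl refl =
  length-≤ (λ w w′ → map (swap k) w ≡ w′)
    (Unique.filter⁺ (¬? ∘ infix? _≟_ q) (Unique.filter⁺ (infix? _≟_ p) (ballotPermutations-unique n d)))
    (λ {w} w∈ →
      let w∈′ , q⋢w  = ∈-filter⁻ (¬? ∘ infix? _≟_ q) {xs = containing n d p} w∈
          good , p⊑w = ∈-containing⁻ n d w∈′
          nonAdj     = separates (BallotPermutation⇒Unique {d = d} {w} good) p⊑w q⋢w
      in map (swap k) w
       , ∈-filter⁺ (¬? ∘ infix? _≟_ _)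
           (∈-containing⁺ (Factor-map (swap k) p⊑w) (swap-BallotPermutation 1≤k k<n nonAdj good))
           (λ q′⊑w′ → q⋢w (subst (Factor q) (map-swap-involutive k w) (Factor-map (swap k) q′⊑w′)))
       , refl)
    (λ { _ refl eq → trans (sym (map-swap-involutive k _)) (trans (cong (map (swap k)) (sym eq)) (map-swap-involutive k _)) })

-- Swapping matches the words with `p` but not `q` to those with `p′` but not `q′`. The difference
-- of counts is written as an equation of sums to stay within the natural numbers.
swap-count : ∀ {k n d p q p′ q′} → 1 ≤ k → suc k ≤ n →
             Separates k p q → Separates k p′ q′ →
             (∀ {w} → Factor q w → Factor p w) → (∀ {w} → Factor q′ w → Factor p′ w) →
             map (swap k) p ≡ p′ → map (swap k) q ≡ q′ →
             count n d p + count n d q′ ≡ count n d p′ + count n d q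
swap-count {k} {n} {d} {p} {q} 1≤k k<n sep sep′ q⊒p q′⊒p′ refl refl = begin
  count n d p + count n d q′                          ≡⟨ cong (_+ count n d q′) (split-count p q q⊒p) ⟩
  count n d q + X + count n d q′                      ≡⟨ +-comm _ (count n d q′) ⟩
  count n d q′ + (count n d q + X)                    ≡⟨ cong (count n d q′ +_) (+-comm (count n d q) X) ⟩
  count n d q′ + (X + count n d q)                    ≡⟨ +-assoc (count n d q′) X _ ⟨
  count n d q′ + X + count n d q                      ≡⟨ cong (λ m → count n d q′ + m + count n d q) X≡X′ ⟩
  count n d q′ + X′ + count n d q                     ≡⟨ cong (_+ count n d q) (split-count p′ q′ q′⊒p′) ⟨
  count n d p′ + count n d q                          ∎
  where
  open ≡-Reasoning
  p′ = map (swap k) p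
  q′ = map (swap k) q
  X  = length (avoiding n d p q)
  X′ = length (avoiding n d p′ q′)

  split-count : ∀ p q → (∀ {w} → Factor q w → Factor p w) →
                count n d p ≡ count n d q + length (avoiding n d p q)
  split-count p q q⊒p = length-filter-split (infix? _≟_ p) (infix? _≟_ q) q⊒p (ballotPermutations n d)

  X≡X′ : X ≡ X′
  X≡X′ = ≤-antisym
    (swap-≤ p q 1≤k k<n sep refl (map-swap-involutive k q))
    (swap-≤ p′ q′ 1≤k k<n sep′ (map-swap-involutive k p) refl)

module _ {k l m z : ℕ} (l≢m : l ≢ m) where

  -- The single occurrence of `k` is followed by `m`, which is not `l`; and if `l` preceded it, the
  -- excluded longer factor would appear.
  prefixed-nonadjacent : Unique w → Factor (k ∷ m ∷ z ∷ []) w → ¬ Factor (l ∷ k ∷ m ∷ z ∷ []) w →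
                         ¬ Factor (k ∷ l ∷ []) w × ¬ Factor (l ∷ k ∷ []) w
  prefixed-nonadjacent unique kmz ¬lkmz with u , v , refl ← split kmz =
    (λ kl → let u′ , v′ , eq = split kl
            in l≢m (sym (∷-injectiveˡ (proj₂ (split-unique u unique eq))))) ,
    (λ lk → let u′ , v′ , eq = split lk
                u≡ = proj₁ (split-unique u unique (trans eq (sym (∷ʳ-++ u′ l (k ∷ v′)))))
            in ¬lkmz (unsplit u′ (trans (cong (_++ _) u≡) (∷ʳ-++ u′ l (k ∷ m ∷ z ∷ v)))))

  suffixed-nonadjacent : Unique w → Factor (z ∷ m ∷ k ∷ []) w → ¬ Factor (z ∷ m ∷ k ∷ l ∷ []) w →
                         ¬ Factor (k ∷ l ∷ []) w × ¬ Factor (l ∷ k ∷ []) w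
  suffixed-nonadjacent {w} unique zmk ¬zmkl with u , v , refl ← split zmk =
    (λ kl → let u′ , v′ , eq = split kl
                v≡ = proj₂ (split-unique (u ∷ʳ z ∷ʳ m) unique′ (trans (sym regroup) eq))
            in ¬zmkl (unsplit u (cong (λ t → u ++ z ∷ m ∷ k ∷ t) v≡))) ,
    (λ lk → let u′ , v′ , eq = split lk
                u≡ = proj₁ (split-unique (u ∷ʳ z ∷ʳ m) unique′
                       (trans (sym regroup) (trans eq (sym (∷ʳ-++ u′ l (k ∷ v′))))))
            in l≢m (sym (∷ʳ-injectiveʳ (u ∷ʳ z) u′ u≡)))
    where
    -- Here `k` comes last in the factor, so the word is regrouped to make `k` the pivot of
    -- `split-unique`.
    regroup : u ++ z ∷ m ∷ k ∷ v ≡ (u ∷ʳ z ∷ʳ m) ++ k ∷ v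
    regroup = sym (trans (∷ʳ-++ (u ∷ʳ z) m _) (∷ʳ-++ u z _))

    unique′ : Unique ((u ∷ʳ z ∷ʳ m) ++ k ∷ v)
    unique′ = subst Unique regroup unique

-- Sliding a step past the peak

Permutation-resp-↭ : v ↭ w → Permutation n v → Permutation n w
Permutation-resp-↭ v↭w (len , inRange , unique) =
  trans (sym (↭-length v↭w)) len , All-resp-↭ v↭w inRange , ↭ₛ.Unique-resp-↭ (setoid ℕ) (↭⇒↭ₛ v↭w) unique

-- With `a` at the head, the tail uses exactly the letters other than `a`, and these are carried to
-- the letters other than `c`.
relabel-Permutation : InRange n c → Permutation n (a ∷ w) → Permutation n (c ∷ map (relabel a c) w)
relabel-Permutation {n} {c} {a} {w} c-inRange (len , a-inRange ∷ inRange , a∉w ∷ unique) =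
  trans (cong suc (length-map (relabel a c) w)) len ,
  c-inRange ∷ All.map⁺ (All.zipWith (λ (a≢x , x-inRange) →
    relabel-InRange a-inRange (proj₁ c-inRange) (≢-sym a≢x) x-inRange) (a∉w , inRange)) ,
  All.map⁺ (All.universal (λ x → ≢-sym (relabel-≢ a c x)) w) ∷
  -- `relabel a c` is injective only away from `a`, so distinctness is pulled back along the inverse
  -- relabelling instead.
  Unique.map⁻ {f = relabel c a} (subst Unique (sym inverse) unique)
  where
  inverse : map (relabel c a) (map (relabel a c) w) ≡ w
  inverse = trans (sym (map-∘ w)) (map-id-local (All.map (relabel-inverse a c ∘ ≢-sym) a∉w))

relabel-steps : All (a ≢_) w → steps (map (relabel a c) w) ≡ steps w
relabel-steps {a} {w} {c} a∉w = steps-map (relabel a c) w λ { u refl →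
  case All.++⁻ʳ u a∉w of λ { (a≢x ∷ a≢y ∷ _) → step-preserved (relabel a c)
    (relabel-mono-< a c (≢-sym a≢x) (≢-sym a≢y)) (relabel-mono-< a c (≢-sym a≢y) (≢-sym a≢x)) } }

map-relabel-inverse : All (a ≢_) w → map (relabel c a) (map (relabel a c) w) ≡ w
map-relabel-inverse {a} {w} {c} a∉w =
  trans (sym (map-∘ w)) (map-id-local (All.map (relabel-inverse a c ∘ ≢-sym) a∉w))

-- The outer parts of the two walks agree. In between, the first takes `step x a`, up, down, and the
-- second takes up, down and the equal `step c y′`, so `run-slide` applies.
profile-slide : ∀ {u u′ v v′} → x < n → a < n → y < n → x′ < n → c < n → y′ < n → step x a ≡ step c y′ →
                steps (u ∷ʳ x) ≡ steps (u′ ∷ʳ x′) → steps (y ∷ v) ≡ steps (y′ ∷ v′) →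
                profile (u ++ x ∷ a ∷ n ∷ y ∷ v) ≡ profile (u′ ++ x′ ∷ n ∷ c ∷ y′ ∷ v′)
profile-slide {x} {n} {a} {y} {x′} {c} {y′} {u} {u′} {v} {v′} x<n a<n y<n x′<n c<n y′<n xa≡cy′ ux≡ yv≡ = begin
  run 0 (steps (u ++ x ∷ a ∷ n ∷ y ∷ v))
    ≡⟨ cong (run 0) (steps-++ u) ⟩
  run 0 (steps (u ∷ʳ x) ++ step x a ∷ step a n ∷ step n y ∷ steps (y ∷ v))
    ≡⟨ cong (run 0) (cong₂ _++_ ux≡ (cong₂ _∷_ xa≡cy′ (cong₂ _∷_ (step-< a<n) (cong₂ _∷_ (step-> y<n) yv≡)))) ⟩
  run 0 (steps (u′ ∷ʳ x′) ++ step c y′ ∷ up ∷ down ∷ steps (y′ ∷ v′))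
    ≡⟨ run-++ (steps (u′ ∷ʳ x′)) (run-slide (step c y′)) 0 ⟩
  run 0 (steps (u′ ∷ʳ x′) ++ up ∷ down ∷ step c y′ ∷ steps (y′ ∷ v′))
    ≡⟨ cong (λ ss → run 0 (steps (u′ ∷ʳ x′) ++ ss))
         (cong₂ _∷_ (step-< x′<n) (cong (_∷ _) (step-> c<n))) ⟨
  run 0 (steps (u′ ∷ʳ x′) ++ step x′ n ∷ step n c ∷ step c y′ ∷ steps (y′ ∷ v′))
    ≡⟨ cong (run 0) (steps-++ u′) ⟨
  run 0 (steps (u′ ++ x′ ∷ n ∷ c ∷ y′ ∷ v′)) ∎
  where open ≡-Reasoning

-- Brings the letter to be replaced to the head, as `relabel-Permutation` expects it.
bring-second : ∀ (u : Word) x a v → u ++ x ∷ a ∷ v ↭ a ∷ u ++ x ∷ v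
bring-second u x a v = ↭-trans (++⁺ˡ u (↭.swap x a ↭.refl)) (shift a u (x ∷ v))

bring-third : ∀ (u : Word) x y a v → u ++ x ∷ y ∷ a ∷ v ↭ a ∷ u ++ x ∷ y ∷ v
bring-third u x y a v = ↭-trans (++⁺ˡ u (shift a (x ∷ y ∷ []) v)) (shift a u (x ∷ y ∷ v))

map-relabel : ∀ {u v} → a < n → c < n → relabel a c x ≡ x′ → relabel a c y ≡ y′ →
              map (relabel a c) (u ++ x ∷ n ∷ y ∷ v) ≡
              map (relabel a c) u ++ x′ ∷ n ∷ y′ ∷ map (relabel a c) v
map-relabel {a} {n} {c} {x = x} {y = y} {u = u} {v} a<n c<n refl refl =
  trans (map-++ (relabel a c) u _)
    (cong (λ m → map (relabel a c) u ++ relabel a c x ∷ m ∷ relabel a c y ∷ map (relabel a c) v) (relabel-> a<n c<n))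

∉-around : ∀ u {v} → All (a ≢_) (u ++ x ∷ n ∷ y ∷ v) → All (a ≢_) (u ∷ʳ x) × All (a ≢_) (y ∷ v)
∉-around u a∉ with a∉u , a≢x ∷ _ ∷ a∉yv ← All.++⁻ u a∉ = All.∷ʳ⁺ a∉u a≢x , a∉yv

relabel-steps-around : ∀ u {v} → All (a ≢_) (u ++ x ∷ n ∷ y ∷ v) → relabel a c x ≡ x′ → relabel a c y ≡ y′ →
                       steps (map (relabel a c) u ∷ʳ x′) ≡ steps (u ∷ʳ x) ×
                       steps (y′ ∷ map (relabel a c) v) ≡ steps (y ∷ v)
relabel-steps-around {a} {x = x} {c = c} u a∉ refl refl =
  let a∉ux , a∉yv = ∉-around u a∉
  in trans (cong steps (sym (map-++ (relabel a c) u (x ∷ [])))) (relabel-steps a∉ux) , relabel-steps a∉yv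

-- Words u x a n y v and u′ x′ n c y′ v′ whose parts other than a and c correspond
-- under relabel a c.
record Slide (n a c x y x′ y′ : ℕ) : Set where
  field
    1≤a  : 1 ≤ a
    1≤c  : 1 ≤ c
    a<n  : a < n
    c<n  : c < n
    x<n  : x < n
    y<n  : y < n
    x′<n : x′ < n
    y′<n : y′ < n
    x≢a  : x ≢ a
    y≢a  : y ≢ a
    x↦x′ : relabel a c x ≡ x′
    y↦y′ : relabel a c y ≡ y′
    xa≡cy′ : step x a ≡ step c y′

  a-inRange : InRange n a
  a-inRange = 1≤a , <⇒≤ a<n

  c-inRange : InRange n c
  c-inRange = 1≤c , <⇒≤ c<n

  x′↦x : relabel c a x′ ≡ x
  x′↦x = trans (cong (relabel c a) (sym x↦x′)) (relabel-inverse a c x≢a)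

  y′↦y : relabel c a y′ ≡ y
  y′↦y = trans (cong (relabel c a) (sym y↦y′)) (relabel-inverse a c y≢a)

-- The letter `x′` occurs once in an image, so it locates the factor there and recovers the
-- relabelled outer parts; these avoided `a` before, so the relabelling can be undone. The first
-- letters are separated from `p` and `p′` to serve as pivots.
relabel-≤ : ∀ p p′ →
            (∀ u v → BallotPermutation n d (u ++ x ∷ p ++ v) →
               All (a ≢_) u × All (a ≢_) v ×
               BallotPermutation n d (map (relabel a c) u ++ x′ ∷ p′ ++ map (relabel a c) v)) →
            count n d (x ∷ p) ≤ count n d (x′ ∷ p′)
relabel-≤ {n} {d} {x} {a} {c} {x′} p p′ transfer =
  length-≤ Related (Unique.filter⁺ (infix? _≟_ (x ∷ p)) (ballotPermutations-unique n d))
    (λ w∈ → let good , p⊑w   = ∈-containing⁻ n d w∈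
                u , v , w≡   = split p⊑w
                a∉u , a∉v , good′ = transfer u v (subst (BallotPermutation n d) w≡ good)
            in _ , ∈-containing⁺ (unsplit _ refl) good′ , u , v , w≡ , refl , a∉u , a∉v)
    injective
  where
  Related : Word → Word → Set
  Related w w′ = ∃₂ λ u v → w ≡ u ++ (x ∷ p) ++ v ×
    w′ ≡ map (relabel a c) u ++ (x′ ∷ p′) ++ map (relabel a c) v × All (a ≢_) u × All (a ≢_) v

  relabel-injective : ∀ {u v} → All (a ≢_) u → All (a ≢_) v → map (relabel a c) u ≡ map (relabel a c) v → u ≡ v
  relabel-injective a∉u a∉v eq =
    trans (sym (map-relabel-inverse a∉u)) (trans (cong (map (relabel c a)) eq) (map-relabel-inverse a∉v))

  injective : ∀ {w₁ w₂ w′} → w′ ∈ containing n d (x′ ∷ p′) → Related w₁ w′ → Related w₂ w′ → w₁ ≡ w₂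
  injective w′∈ (u₁ , v₁ , refl , refl , a∉u₁ , a∉v₁) (u₂ , v₂ , refl , eq , a∉u₂ , a∉v₂) =
    let u≡ , p′v≡ = split-unique (map (relabel a c) u₁)
                      (BallotPermutation⇒Unique {d = d} (proj₁ (∈-containing⁻ n d w′∈))) eq
    in cong₂ (λ u v → u ++ (x ∷ p) ++ v) (relabel-injective a∉u₁ a∉u₂ u≡)
         (relabel-injective a∉v₁ a∉v₂ (++-cancelˡ p′ _ _ p′v≡))

module _ (slide : Slide n a c x y x′ y′) where
  open Slide slide

  -- Moving `a` to the front, relabelling and moving `c` back in behind `n` gives a permutation;
  -- `profile-slide` supplies the ballot condition and the descents.
  slide-right : ∀ u v → BallotPermutation n d (u ++ x ∷ a ∷ n ∷ y ∷ v) →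
    All (a ≢_) u × All (a ≢_) v ×
    BallotPermutation n d (map (relabel a c) u ++ x′ ∷ n ∷ c ∷ y′ ∷ map (relabel a c) v)
  slide-right u v good@(perm , _) with perm′@(_ , _ , a∉ ∷ _) ← Permutation-resp-↭ (bring-second u x a _) perm =
    let left , right = relabel-steps-around u a∉ x↦x′ y↦y′ in
    All.++⁻ˡ u a∉ , All.tail (proj₂ (∉-around u a∉)) ,
    profile-preserves (profile-slide {u = u} x<n a<n y<n x′<n c<n y′<n xa≡cy′ (sym left) (sym right))
      (Permutation-resp-↭ (↭-sym (bring-third _ x′ n c _))
        (subst (λ w → Permutation n (c ∷ w)) (map-relabel {u = u} a<n c<n x↦x′ y↦y′) (relabel-Permutation c-inRange perm′)))
      good

  slide-left : ∀ u v → BallotPermutation n d (u ++ x′ ∷ n ∷ c ∷ y′ ∷ v) →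
    All (c ≢_) u × All (c ≢_) v ×
    BallotPermutation n d (map (relabel c a) u ++ x ∷ a ∷ n ∷ y ∷ map (relabel c a) v)
  slide-left u v good@(perm , _) with perm′@(_ , _ , c∉ ∷ _) ← Permutation-resp-↭ (bring-third u x′ n c _) perm =
    let left , right = relabel-steps-around u c∉ x′↦x y′↦y in
    All.++⁻ˡ u c∉ , All.tail (proj₂ (∉-around u c∉)) ,
    profile-preserves (sym (profile-slide {u = map (relabel c a) u} x<n a<n y<n x′<n c<n y′<n xa≡cy′ left right))
      (Permutation-resp-↭ (↭-sym (bring-second _ x a _))
        (subst (λ w → Permutation n (a ∷ w)) (map-relabel {u = u} c<n a<n x′↦x y′↦y) (relabel-Permutation a-inRange perm′)))
      good

  slide-count : ∀ d → count n d (x ∷ a ∷ n ∷ y ∷ []) ≡ count n d (x′ ∷ n ∷ c ∷ y′ ∷ [])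
  slide-count d = ≤-antisym
    (relabel-≤ (a ∷ n ∷ y ∷ []) (n ∷ c ∷ y′ ∷ []) slide-right)
    (relabel-≤ (n ∷ c ∷ y′ ∷ []) (a ∷ n ∷ y ∷ []) slide-left)

-- Comparing neighbouring matrix entries

Factor-++ˡ : ∀ {p} q → Factor (q ++ p) w → Factor p w
Factor-++ˡ {p = p} q qp with u , v , refl ← split qp =
  unsplit (u ++ q) (trans (cong (u ++_) (++-assoc q p v)) (sym (++-assoc u q (p ++ v))))

Factor-++ʳ : ∀ p {q} → Factor (p ++ q) w → Factor p w
Factor-++ʳ p {q} pq with u , v , refl ← split pq = unsplit u (cong (u ++_) (++-assoc p q v))

module _ {n k : ℕ} (1≤k : 1 ≤ k) (1+k<n : suc k < n) (d : ℤ) where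

  private
    n≢k : n ≢ k
    n≢k = >⇒≢ (<-trans ≤-refl 1+k<n)

    n≢1+k : n ≢ suc k
    n≢1+k = >⇒≢ 1+k<n

    swap-triple : ∀ {x x′ y y′ z z′} → swap k x ≡ x′ → swap k y ≡ y′ → swap k z ≡ z′ →
                  map (swap k) (x ∷ y ∷ z ∷ []) ≡ x′ ∷ y′ ∷ z′ ∷ []
    swap-triple refl refl refl = refl

    swap-n : swap k n ≡ n
    swap-n = swap-fixed k n n≢k n≢1+k

  swap-before : y ≢ k → y ≢ suc k →
    count n d (k ∷ n ∷ y ∷ []) + count n d (k ∷ suc k ∷ n ∷ y ∷ []) ≡
    count n d (suc k ∷ n ∷ y ∷ []) + count n d (suc k ∷ k ∷ n ∷ y ∷ [])
  swap-before {y} y≢k y≢1+k = swap-count 1≤k (<⇒≤ 1+k<n)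
    (prefixed-nonadjacent (≢-sym n≢1+k))
    -- In the swapped patterns `k` and `suc k` exchange roles, while `NonAdjacent k` lists the two
    -- orders in a fixed sequence.
    (λ unique p⊑w q⋢w → ×-swap (prefixed-nonadjacent (≢-sym n≢k) unique p⊑w q⋢w))
    (Factor-++ˡ (suc k ∷ [])) (Factor-++ˡ (k ∷ []))
    (swap-triple (swap-k k) swap-n swap-y)
    (cong₂ _∷_ (swap-1+k k) (swap-triple (swap-k k) swap-n swap-y))
    where
    swap-y : swap k y ≡ y
    swap-y = swap-fixed k y y≢k y≢1+k

  swap-after : x ≢ k → x ≢ suc k →
    count n d (x ∷ n ∷ k ∷ []) + count n d (x ∷ n ∷ suc k ∷ k ∷ []) ≡
    count n d (x ∷ n ∷ suc k ∷ []) + count n d (x ∷ n ∷ k ∷ suc k ∷ [])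
  swap-after {x} x≢k x≢1+k = swap-count 1≤k (<⇒≤ 1+k<n)
    (suffixed-nonadjacent (≢-sym n≢1+k))
    (λ unique p⊑w q⋢w → ×-swap (suffixed-nonadjacent (≢-sym n≢k) unique p⊑w q⋢w))
    (Factor-++ʳ (x ∷ n ∷ k ∷ [])) (Factor-++ʳ (x ∷ n ∷ suc k ∷ []))
    (swap-triple swap-x swap-n (swap-k k))
    (cong₂ _∷_ swap-x (cong₂ _∷_ swap-n (cong₂ _∷_ (swap-k k) (cong (_∷ []) (swap-1+k k)))))
    where
    swap-x : swap k x ≡ x
    swap-x = swap-fixed k x x≢k x≢1+k

-- Shifting along the diagonals

b-diagonal : ∀ n d i → b n d i i ≡ 0
b-diagonal n d i with containing n d (i ∷ n ∷ i ∷ []) in eq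
... | []    = refl
-- A listed word would have `i` on both sides of `n`, against the distinctness of its letters.
... | w ∷ _ with good , p⊑w ← ∈-containing⁻ n d (subst (w ∈_) (sym eq) (here refl))
            with u , v , refl ← split p⊑w = contradiction refl (distinct u (BallotPermutation⇒Unique {d = d} good))
  where
  distinct : ∀ u {v x y z} → Unique (u ++ x ∷ y ∷ z ∷ v) → x ≢ z
  distinct []      ((_ ∷ x≢z ∷ _) ∷ _) = x≢z
  distinct (_ ∷ u) (_ ∷ unique)        = distinct u unique

module _ {n i j : ℕ} (1≤i : 1 ≤ i) (1≤j : 1 ≤ j) (1+i<n : suc i < n) (1+j<n : suc j < n) where
  private
    i<n = <-trans ≤-refl 1+i<n
    j<n = <-trans ≤-refl 1+j<n

  -- The route through `b n d i (suc j)` keeps the fixed letter clear of the swapped pair in both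
  -- exchanges; through `b n d (suc i) j` this would fail for `j` equal to `suc i`.
  b-shift-< : ∀ d → i < j → b n d (suc i) (suc j) ≡ b n d i j
  b-shift-< d i<j = +-cancelʳ-≡ (count n d (suc i ∷ i ∷ n ∷ suc j ∷ [])) _ _ (begin
    b n d (suc i) (suc j) + count n d (suc i ∷ i ∷ n ∷ suc j ∷ [])
      ≡⟨ swap-before 1≤i 1+i<n d (>⇒≢ (m<n⇒m<1+n i<j)) (>⇒≢ (s≤s i<j)) ⟨
    b n d i (suc j) + count n d (i ∷ suc i ∷ n ∷ suc j ∷ [])
      ≡⟨ cong (b n d i (suc j) +_) (slide-count ascending d) ⟩
    b n d i (suc j) + count n d (i ∷ n ∷ j ∷ suc j ∷ [])
      ≡⟨ swap-after 1≤j 1+j<n d (<⇒≢ i<j) (<⇒≢ (m<n⇒m<1+n i<j)) ⟨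
    b n d i j + count n d (i ∷ n ∷ suc j ∷ j ∷ [])
      ≡⟨ cong (b n d i j +_) (slide-count descending d) ⟨
    b n d i j + count n d (suc i ∷ i ∷ n ∷ suc j ∷ []) ∎)
    where
    open ≡-Reasoning
    -- The neighbours `i` and `suc j` lie outside the range that the relabelling moves, so they
    -- stay.
    ascending : Slide n (suc i) j i (suc j) i (suc j)
    ascending = record
      { 1≤a = s≤s z≤n ; 1≤c = 1≤j
      ; a<n = 1+i<n ; c<n = j<n ; x<n = i<n ; y<n = 1+j<n ; x′<n = i<n ; y′<n = 1+j<n
      ; x≢a = <⇒≢ ≤-refl ; y≢a = >⇒≢ (s≤s i<j)
      ; x↦x′ = relabel-< ≤-refl i<j ; y↦y′ = relabel-> (s≤s i<j) ≤-refl
      ; xa≡cy′ = trans (step-< {i} ≤-refl) (sym (step-< {j} ≤-refl)) }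

    -- Here the letters from `suc i` to `suc j` all drop by one, including both neighbours.
    descending : Slide n i (suc j) (suc i) (suc j) i j
    descending = record
      { 1≤a = 1≤i ; 1≤c = s≤s z≤n
      ; a<n = i<n ; c<n = 1+j<n ; x<n = 1+i<n ; y<n = 1+j<n ; x′<n = i<n ; y′<n = j<n
      ; x≢a = >⇒≢ ≤-refl ; y≢a = >⇒≢ (m<n⇒m<1+n i<j)
      ; x↦x′ = relabel-down ≤-refl (m<n⇒m<1+n i<j) ; y↦y′ = relabel-down (<⇒≤ i<j) ≤-refl
      ; xa≡cy′ = trans (step-> {suc i} ≤-refl) (sym (step-> {suc j} ≤-refl)) }

  -- Below the diagonal the safe intermediate entry is `b n d (suc i) j`, since `suc j` may coincide
  -- with `i`. Now the ascending slide shifts both neighbours up and the descending one fixes them.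
  b-shift-> : ∀ d → j < i → b n d (suc i) (suc j) ≡ b n d i j
  b-shift-> d j<i = +-cancelʳ-≡ (count n d (suc i ∷ n ∷ j ∷ suc j ∷ [])) _ _ (begin
    b n d (suc i) (suc j) + count n d (suc i ∷ n ∷ j ∷ suc j ∷ [])
      ≡⟨ swap-after 1≤j 1+j<n d (>⇒≢ (m<n⇒m<1+n j<i)) (>⇒≢ (s≤s j<i)) ⟨
    b n d (suc i) j + count n d (suc i ∷ n ∷ suc j ∷ j ∷ [])
      ≡⟨ cong (b n d (suc i) j +_) (slide-count descending d) ⟨
    b n d (suc i) j + count n d (suc i ∷ i ∷ n ∷ j ∷ [])
      ≡⟨ swap-before 1≤i 1+i<n d (<⇒≢ j<i) (<⇒≢ (m<n⇒m<1+n j<i)) ⟨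
    b n d i j + count n d (i ∷ suc i ∷ n ∷ j ∷ [])
      ≡⟨ cong (b n d i j +_) (slide-count ascending d) ⟩
    b n d i j + count n d (suc i ∷ n ∷ j ∷ suc j ∷ []) ∎)
    where
    open ≡-Reasoning
    ascending : Slide n (suc i) j i j (suc i) (suc j)
    ascending = record
      { 1≤a = s≤s z≤n ; 1≤c = 1≤j
      ; a<n = 1+i<n ; c<n = j<n ; x<n = i<n ; y<n = j<n ; x′<n = 1+i<n ; y′<n = 1+j<n
      ; x≢a = <⇒≢ ≤-refl ; y≢a = <⇒≢ (m<n⇒m<1+n j<i)
      ; x↦x′ = relabel-up (<⇒≤ j<i) ≤-refl ; y↦y′ = relabel-up ≤-refl (m<n⇒m<1+n j<i)
      ; xa≡cy′ = trans (step-< {i} ≤-refl) (sym (step-< {j} ≤-refl)) }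

    descending : Slide n i (suc j) (suc i) j (suc i) j
    descending = record
      { 1≤a = 1≤i ; 1≤c = s≤s z≤n
      ; a<n = i<n ; c<n = 1+j<n ; x<n = 1+i<n ; y<n = j<n ; x′<n = 1+i<n ; y′<n = j<n
      ; x≢a = >⇒≢ ≤-refl ; y≢a = <⇒≢ j<i
      ; x↦x′ = relabel-> ≤-refl (s≤s j<i) ; y↦y′ = relabel-< j<i ≤-refl
      ; xa≡cy′ = trans (step-> {suc i} ≤-refl) (sym (step-> {suc j} ≤-refl)) }

theorem3p1 : ∀ (n : ℕ) → n ≥ 2 → ∀ (d : ℤ) → Toeplitz (B n d)
theorem3p1 (suc m) _ d i j i⁺ j⁺ i⁺≡ j⁺≡ rewrite i⁺≡ | j⁺≡ = shift-diagonal
  where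
  -- Index `toℕ i` stands for the letter `suc (toℕ i)`, so the shifted letter is `2 + toℕ i`; the
  -- existence of `i⁺` keeps it below the maximum `suc m`.
  bound : ∀ (i i⁺ : Fin m) → toℕ i⁺ ≡ suc (toℕ i) → 2 + toℕ i < suc m
  bound i i⁺ eq = s≤s (subst (_< m) eq (toℕ<n i⁺))

  shift-diagonal : b (suc m) d (2 + toℕ i) (2 + toℕ j) ≡ b (suc m) d (suc (toℕ i)) (suc (toℕ j))
  shift-diagonal with <-cmp (toℕ i) (toℕ j)
  ... | tri< i<j _ _ = b-shift-< (s≤s z≤n) (s≤s z≤n) (bound i i⁺ i⁺≡) (bound j j⁺ j⁺≡) d (s≤s i<j)
  ... | tri> _ _ j<i = b-shift-> (s≤s z≤n) (s≤s z≤n) (bound i i⁺ i⁺≡) (bound j j⁺ j⁺≡) d (s≤s j<i)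
  ... | tri≈ _ i≡j _ rewrite i≡j =
    trans (b-diagonal (suc m) d (2 + toℕ j)) (sym (b-diagonal (suc m) d (suc (toℕ j))))
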